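{- For all finite sets of formulas $\Gamma,\Delta$: if the sequent $\Gamma\Rightarrow\Delta$ is provable in $\mathsf{CLp}$, then $\Gamma\Vdash\Delta$.
   Context: Fix a countably infinite set $\mathsf{At}$ of atoms. Formulas are built from atoms and the constant $\bot$ using the binary connectives $\land,\lor,\to$. All contexts are finite sets (not multisets) of formulas; a comma denotes union; a subscript $\mathsf{At}$ indicates a finite set of atoms. An atomic sequent has the form $\Gamma_{\mathsf{At}} \Rightarrow \Delta_{\mathsf{At}}$. An atomic rule has finitely many (possibly zero) atomic sequents as premises and one atomic sequent as conclusion; a rule with zero premises is an atomic axiom. A base is a (possibly empty) set of atomic rules; $\mathcal{C}\supseteq\mathcal{B}$ ($\mathcal{C}$ extends $\mathcal{B}$) if $\mathcal{C}$ contains every rule of $\mathcal{B}$. Derivability $\vdash_{\mathcal{B}}$ of atomic sequents is the least relation such that: (Axiom/Weakening) if an atomic axiom with conclusion $\Gamma_{\mathsf{At}}\Rightarrow\Delta_{\mathsf{At}}$ is in $\mathcal{B}$, then $\vdash_{\mathcal{B}} \Theta_{\mathsf{At}},\Gamma_{\mathsf{At}}\Rightarrow\Delta_{\mathsf{At}},\Sigma_{\mathsf{At}}$ for all sets of atoms $\Theta_{\mathsf{At}},\Sigma_{\mathsf{At}}$; (Mix) if a rule with premises $\Gamma^i_{\mathsf{At}}\Rightarrow\Delta^i_{\mathsf{At}}$ ($1\le i\le n$) and conclusion $\Gamma_{\mathsf{At}}\Rightarrow\Delta_{\mathsf{At}}$ is in $\mathcal{B}$ and $\vdash_{\mathcal{B}}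 \Theta^i_{\mathsf{At}},\Gamma^i_{\mathsf{At}}\Rightarrow\Delta^i_{\mathsf{At}},\Sigma^i_{\mathsf{At}}$ for each $i$, then $\vdash_{\mathcal{B}} \Theta^1_{\mathsf{At}},\dots,\Theta^n_{\mathsf{At}},\Gamma_{\mathsf{At}}\Rightarrow\Delta_{\mathsf{At}},\Sigma^1_{\mathsf{At}},\dots,\Sigma^n_{\mathsf{At}}$. Support $\Vdash_{\mathcal{B}}$: (At) $\Vdash_{\mathcal{B}}\Gamma_{\mathsf{At}}$ iff $\vdash_{\mathcal{B}}\ \Rightarrow\Gamma_{\mathsf{At}}$; ($\land$) $\Vdash_{\mathcal{B}} A\land B,\Gamma$ iff $\Vdash_{\mathcal{B}}A,\Gamma$ and $\Vdash_{\mathcal{B}}B,\Gamma$; ($\lor$) $\Vdash_{\mathcal{B}}A\lor B,\Gamma$ iff $\Vdash_{\mathcal{B}}A,B,\Gamma$; ($\to$) $\Vdash_{\mathcal{B}}A\to B,\Gamma$ iff $A\Vdash_{\mathcal{B}}B,\Gamma$; ($\bot$) $\Vdash_{\mathcal{B}}\bot,\Gamma$ iff $\Vdash_{\mathcal{B}}\Gamma$; (Inf) for $n\ge1$, $\{A^1,\dots,A^n\}\Vdash_{\mathcal{B}}\Delta$ iff for every $\mathcal{C}\supseteq\mathcal{B}$ and all sets of atoms $\Theta^1_{\mathsf{At}},\dots,\Theta^n_{\mathsf{At}}$, if $\Vdash_{\mathcal{C}}\Theta^i_{\mathsf{At}},A^i$ for all $i$ then $\Vdash_{\mathcal{C}}\Theta^1_{\mathsf{At}},\dots,\Theta^n_{\mathsf{At}},\Delta$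 (and $\varnothing\Vdash_{\mathcal{B}}\Delta$ means $\Vdash_{\mathcal{B}}\Delta$). The atomic identity rule $\mathsf{Ainit}$ is the atomic axiom $\Gamma_{\mathsf{At}},p\Rightarrow p,\Delta_{\mathsf{At}}$; the atomic cut rule $\mathsf{Acut}$ has premises $\Gamma^1_{\mathsf{At}}\Rightarrow\Delta^1_{\mathsf{At}},p$ and $p,\Gamma^2_{\mathsf{At}}\Rightarrow\Delta^2_{\mathsf{At}}$ and conclusion $\Gamma^1_{\mathsf{At}},\Gamma^2_{\mathsf{At}}\Rightarrow\Delta^1_{\mathsf{At}},\Delta^2_{\mathsf{At}}$. $\mathcal{ST}$ is the base consisting of all instances of $\mathsf{Ainit}$ and $\mathsf{Acut}$ (all atoms $p$, all sets of atoms). Validity: $\Gamma\Vdash\Delta$ iff $\Gamma\Vdash_{\mathcal{B}}\Delta$ for every base $\mathcal{B}\supseteq\mathcal{ST}$. $\mathsf{CLp}$ is the sequent calculus on sequents $\Gamma\Rightarrow\Delta$ (finite sets of formulas) with rules: $\mathsf{init}$: $\Gamma,A\Rightarrow A,\Delta$; $L\bot$: $\Gamma,\bot\Rightarrow\Delta$; $R\bot$: from $\Gamma\Rightarrow\Delta$ infer $\Gamma\Rightarrow\bot,\Delta$; $L\land$: from $A,B,\Gamma\Rightarrow\Delta$ infer $A\land B,\Gamma\Rightarrow\Delta$; $R\land$: from $\Gamma\Rightarrow\Delta,A$ and $\Gamma'\Rightarrow\Delta',B$ infer $\Gamma,\Gamma'\Rightarrow\Delta,\Delta',A\land B$; $L\lor$: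 from $A,\Gamma\Rightarrow\Delta$ and $B,\Gamma'\Rightarrow\Delta'$ infer $A\lor B,\Gamma,\Gamma'\Rightarrow\Delta,\Delta'$; $R\lor$: from $\Gamma\Rightarrow\Delta,A,B$ infer $\Gamma\Rightarrow\Delta,A\lor B$; $L\to$: from $\Gamma\Rightarrow\Delta,A$ and $B,\Gamma'\Rightarrow\Delta'$ infer $A\to B,\Gamma,\Gamma'\Rightarrow\Delta,\Delta'$; $R\to$: from $A,\Gamma\Rightarrow\Delta,B$ infer $\Gamma\Rightarrow\Delta,A\to B$. -}

module Defs where

open import Data.List.Base using (List; []; _∷_; _++_; concat; map)
open import Data.List.Relation.Binary.BagAndSetEquality using (_∼[_]_; set)
open import Data.List.Relation.Binary.Pointwise.Base using (Pointwise)
open import Data.Nat.Base using (ℕ)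
open import Data.Product.Base using (_×_)
open import Level using (0ℓ)
open import Relation.Unary using (Pred)

infix  2 _⊩_ _⊩⟨_⟩_ ⊩[_]_ ⊢[_]_
infix  3 _⟹_
infix  4 _⇒_ _≈_ _≈ˢ_ _≈ᴿ_ _⊇_
infixr 6 _⊃_
infixr 7 _∨_
infixr 8 _∧_

Atom : Set
Atom = ℕ

data Formula : Set where
  atom        : Atom → Formula
  ⊥           : Formula
  _∧_ _∨_ _⊃_ : Formula → Formula → Formula

-- Finite sets are lists taken up to _≈_ (having the same members), and
-- union is _++_.  Everything below is invariant under _≈_: bases and the
-- two derivability relations by fiat, support as a consequence.

FinSet : Set → Set
FinSet = List

_≈_ : {A : Set} → FinSet A → FinSet A → Set
Γ ≈ Δ = Γ ∼[ set ] Δ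

record Sequent (A : Set) : Set where
  constructor _⇒_
  field
    ante : FinSet A
    succ : FinSet A

open Sequent public

record _≈ˢ_ {A : Set} (S T : Sequent A) : Set where
  constructor _,_
  field
    ante-≈ : ante S ≈ ante T
    succ-≈ : succ S ≈ succ T

AtomicSequent : Set
AtomicSequent = Sequent Atom

record AtomicRule : Set where
  constructor _⟹_
  field
    premises   : List AtomicSequent
    conclusion : AtomicSequent

open AtomicRule public

record _≈ᴿ_ (r s : AtomicRule) : Set where
  constructor _,_
  field
    premises-≈   : Pointwise _≈ˢ_ (premises r) (premises s)
    conclusion-≈ : conclusion r ≈ˢ conclusion s

record Base : Set₁ where
  field
    rules : Pred AtomicRule 0ℓ
    resp  : ∀ {r s} → r ≈ᴿ s → rules r → rules s

open Base public

_⊇_ : Base → Base → Set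
C ⊇ B = ∀ {r} → rules B r → rules C r

-- In mix, the i-th entry of Ks is the pair Θⁱ ⇒ Σⁱ of side contexts added
-- to the i-th premise.

data ⊢[_]_ (B : Base) : AtomicSequent → Set₁ where
  axiom : ∀ {Γ Δ} → rules B ([] ⟹ (Γ ⇒ Δ)) →
          ∀ Θ Σ → ⊢[ B ] (Θ ++ Γ ⇒ Δ ++ Σ)
  mix   : ∀ {Ps Γ Δ} → rules B (Ps ⟹ (Γ ⇒ Δ)) →
          ∀ Ks → Pointwise (λ P K → ⊢[ B ] (ante K ++ ante P ⇒ succ P ++ succ K)) Ps Ks →
          ⊢[ B ] (concat (map ante Ks) ++ Γ ⇒ Δ ++ concat (map succ Ks))
  conv  : ∀ {S T} → S ≈ˢ T → ⊢[ B ] S → ⊢[ B ] T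

-- Support is defined on sets split as Θ_At , Γ.  The recursion is structural
-- on one formula A of the set at a time, with K B Θ the support at B of
-- Θ_At together with the members not yet decomposed: thus supp A K B Θ
-- stands for ⊩_B Θ_At , A , Γ when K B Θ stands for ⊩_B Θ_At , Γ.  The
-- case of ⊃ is the clause for A ⊩_B D , Θ_At , Γ (Inf with one antecedent)
-- written out.

Support : Set₂
Support = Base → FinSet Atom → Set₁

supp-At : Support
supp-At B Θ = ⊢[ B ] ([] ⇒ Θ)

supp : Formula → Support → Support
supp (atom p) K B Θ = K B (p ∷ Θ)
supp ⊥        K B Θ = K B Θ
supp (A ∧ D)  K B Θ = supp A K B Θ × supp D K B Θ
supp (A ∨ D)  K B Θ = supp A (supp D K) B Θ
supp (A ⊃ D)  K B Θ = ∀ C → C ⊇ B → ∀ Ξ → supp A supp-At C Ξ → supp D K C (Ξ ++ Θ)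

supp* : FinSet Formula → Support
supp* []      = supp-At
supp* (A ∷ Γ) = supp A (supp* Γ)

⊩[_]_ : Base → FinSet Formula → Set₁
⊩[ B ] Γ = supp* Γ B []

-- The i-th entry of Θs is Θⁱ.  A list Γ with repetitions is harmless, since
-- support is closed under weakening.

_⊩⟨_⟩_ : FinSet Formula → Base → FinSet Formula → Set₁
[]        ⊩⟨ B ⟩ Δ = ⊩[ B ] Δ
Γ@(_ ∷ _) ⊩⟨ B ⟩ Δ =
  ∀ C → C ⊇ B → ∀ Θs →
  Pointwise (λ Θ A → ⊩[ C ] (map atom Θ ++ A ∷ [])) Θs Γ →
  ⊩[ C ] (map atom (concat Θs) ++ Δ)

data STRule : AtomicRule → Set where
  ainit : ∀ Γ Δ p → STRule ([] ⟹ (Γ ++ p ∷ [] ⇒ p ∷ Δ))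
  acut  : ∀ Γ₁ Δ₁ Γ₂ Δ₂ p →
          STRule (((Γ₁ ⇒ Δ₁ ++ p ∷ []) ∷ (p ∷ Γ₂ ⇒ Δ₂) ∷ []) ⟹ (Γ₁ ++ Γ₂ ⇒ Δ₁ ++ Δ₂))
  conv  : ∀ {r s} → r ≈ᴿ s → STRule r → STRule s

ST : Base
ST = record { rules = STRule ; resp = conv }

_⊩_ : FinSet Formula → FinSet Formula → Set₁
Γ ⊩ Δ = ∀ B → B ⊇ ST → Γ ⊩⟨ B ⟩ Δ

data CLp : Sequent Formula → Set where
  init : ∀ {Γ Δ A} → CLp (Γ ++ A ∷ [] ⇒ A ∷ Δ)
  L⊥   : ∀ {Γ Δ} → CLp (Γ ++ ⊥ ∷ [] ⇒ Δ)
  R⊥   : ∀ {Γ Δ} → CLp (Γ ⇒ Δ) → CLp (Γ ⇒ ⊥ ∷ Δ)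
  L∧   : ∀ {Γ Δ A B} → CLp (A ∷ B ∷ Γ ⇒ Δ) → CLp (A ∧ B ∷ Γ ⇒ Δ)
  R∧   : ∀ {Γ Δ Γ′ Δ′ A B} → CLp (Γ ⇒ Δ ++ A ∷ []) → CLp (Γ′ ⇒ Δ′ ++ B ∷ []) →
         CLp (Γ ++ Γ′ ⇒ Δ ++ Δ′ ++ A ∧ B ∷ [])
  L∨   : ∀ {Γ Δ Γ′ Δ′ A B} → CLp (A ∷ Γ ⇒ Δ) → CLp (B ∷ Γ′ ⇒ Δ′) →
         CLp (A ∨ B ∷ Γ ++ Γ′ ⇒ Δ ++ Δ′)
  R∨   : ∀ {Γ Δ A B} → CLp (Γ ⇒ Δ ++ A ∷ B ∷ []) → CLp (Γ ⇒ Δ ++ A ∨ B ∷ [])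
  L⊃   : ∀ {Γ Δ Γ′ Δ′ A B} → CLp (Γ ⇒ Δ ++ A ∷ []) → CLp (B ∷ Γ′ ⇒ Δ′) →
         CLp (A ⊃ B ∷ Γ ++ Γ′ ⇒ Δ ++ Δ′)
  R⊃   : ∀ {Γ Δ A B} → CLp (A ∷ Γ ⇒ Δ ++ B ∷ []) → CLp (Γ ⇒ Δ ++ A ⊃ B ∷ [])
  conv : ∀ {S T} → S ≈ˢ T → CLp S → CLp T

{-# OPTIONS --safe #-}

-- Read supp A K as "A or K" over worlds (B , Θ), ordered by extension of the
-- base and inclusion of the atoms.  On monotone supports, supp A is functorial
-- for implications valid at all extensions, and satisfies weakening, exchange
-- and contraction, so supp* Γ depends only on the set Γ and is monotone in it.
-- By functoriality, the clause for ⊃, which quantifies over atomic contexts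
-- only, can be used inside an arbitrary context of formulas; this is the cut
-- needed for the left rules.

module Submission where

open import Defs
open import Data.List.Base using (List; []; _∷_; _++_; concat; map)
open import Data.List.Membership.Propositional using (_∈_)
open import Data.List.Membership.Propositional.Properties using (∈-++⁻)
open import Data.List.Properties using (++-assoc)
open import Data.List.Relation.Binary.BagAndSetEquality using (++-cong; ↭⇒∼bag; bag-=⇒)
open import Data.List.Relation.Binary.Permutation.Propositional using (_↭_; ↭-swap; ↭-refl; ↭-reflexive; ↭-sym; ↭-trans)
open import Data.List.Relation.Binary.Permutation.Propositional.Properties using (shift; shifts; ++-comm; ++⁺ˡ; ∈-resp-↭)
open import Data.List.Relation.Binary.Pointwise.Base using (Pointwise; []; _∷_)
open import Data.List.Relation.Binary.Subset.Propositional using (_⊆_)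
open import Data.List.Relation.Binary.Subset.Propositional.Properties using (xs⊆xs++ys; xs⊆ys++xs; ⊆-trans; ∷⁺ʳ; ++⁺ʳ)
open import Data.List.Relation.Unary.All as All using (All; []; _∷_)
open import Data.List.Relation.Unary.All.Properties using (++⁻ˡ; ++⁻ʳ; anti-mono)
open import Data.List.Relation.Unary.Any using (here; there)
open import Data.Product.Base using (_×_; _,_; proj₁; proj₂)
open import Data.Sum.Base using ([_,_])
open import Function.Base using (id; _∘_; _$_)
open import Function.Bundles using (mk⇔; Equivalence)
open import Relation.Binary.PropositionalEquality using (refl; sym)

private
  variable
    A D : Formula
    K L : Support
    B C E : Base
    Γ Δ : FinSet Formula
    Θ Ξ Ψ : FinSet Atom
    p : Atom
    X : Set

↭⇒≈ : {xs ys : FinSet X} → xs ↭ ys → xs ≈ ys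
↭⇒≈ xs↭ys = bag-=⇒ (↭⇒∼bag xs↭ys)

↭⇒⊆ : {xs ys : FinSet X} → xs ↭ ys → xs ⊆ ys
↭⇒⊆ xs↭ys = ∈-resp-↭ xs↭ys

≈⇒⊆ : {xs ys : FinSet X} → xs ≈ ys → xs ⊆ ys
≈⇒⊆ xs≈ys = Equivalence.to xs≈ys

++-lub : {xs ys zs : FinSet X} → xs ⊆ zs → ys ⊆ zs → xs ++ ys ⊆ zs
++-lub {xs = xs} xs⊆zs ys⊆zs = [ xs⊆zs , ys⊆zs ] ∘ ∈-++⁻ xs

≈-refl : {xs : FinSet X} → xs ≈ xs
≈-refl = mk⇔ id id

-- Monotonicity of atomic derivability.

⊢-base-mono : C ⊇ B → ∀ {S} → ⊢[ B ] S → ⊢[ C ] S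
⊢-base-mono {C} {B} C⊇B = go
  where
  Premises : Base → List AtomicSequent → List AtomicSequent → Set₁
  Premises B = Pointwise λ P K → ⊢[ B ] (ante K ++ ante P ⇒ succ P ++ succ K)

  mutual
    go : ∀ {S} → ⊢[ B ] S → ⊢[ C ] S
    go (axiom r Θ Σ) = axiom (C⊇B r) Θ Σ
    go (mix r Ks ds) = mix (C⊇B r) Ks (go* ds)
    go (conv S≈T d)  = conv S≈T (go d)

    go* : ∀ {Ps Ks} → Premises B Ps Ks → Premises C Ps Ks
    go* []       = []
    go* (d ∷ ds) = go d ∷ go* ds

-- A `mix` keeps the side contexts of its premises, so `Σ` is pushed up through the first premise
-- until it meets an axiom, where side contexts are free.
⊢-weakenʳ : ∀ Σ {S} → ⊢[ B ] S → ⊢[ B ] (ante S ⇒ Σ ++ succ S)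
⊢-weakenʳ Σ (axiom {Δ = Δ} r Θ Σ′) =
  conv (≈-refl , ↭⇒≈ (shifts Δ Σ)) (axiom r Θ (Σ ++ Σ′))
-- A zero-premise instance of mix has no side context to enlarge.
⊢-weakenʳ Σ (mix {Δ = Δ} r [] []) =
  conv (≈-refl , ↭⇒≈ (shifts Δ Σ)) (axiom r [] (Σ ++ []))
⊢-weakenʳ Σ (mix {P ∷ _} {Δ = Δ} r (K ∷ Ks) (d ∷ ds)) =
  conv (≈-refl , ↭⇒≈ (↭-trans (++⁺ˡ Δ (↭-reflexive (++-assoc Σ (succ K) _))) (shifts Δ Σ)))
    (mix r ((ante K ⇒ Σ ++ succ K) ∷ Ks)
      (conv (≈-refl , ↭⇒≈ (shifts Σ (succ P))) (⊢-weakenʳ Σ d) ∷ ds))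
⊢-weakenʳ Σ (conv (Γ≈Γ′ , Δ≈Δ′) d) =
  conv (Γ≈Γ′ , ++-cong (≈-refl {xs = Σ}) Δ≈Δ′) (⊢-weakenʳ Σ d)

-- Worlds, monotonicity and functoriality of support.

infix 4 _▸_≼_▸_

record _▸_≼_▸_ (B : Base) (Θ : FinSet Atom) (C : Base) (Ξ : FinSet Atom) : Set where
  constructor _,_
  field
    base-⊇  : C ⊇ B
    atoms-⊆ : Θ ⊆ Ξ

open _▸_≼_▸_

≼-refl : B ▸ Θ ≼ B ▸ Θ
≼-refl = id , id

≼-trans : B ▸ Θ ≼ C ▸ Ξ → C ▸ Ξ ≼ E ▸ Ψ → B ▸ Θ ≼ E ▸ Ψ
≼-trans (C⊇B , Θ⊆Ξ) (E⊇C , Ξ⊆Ψ) = (λ r → E⊇C (C⊇B r)) , (λ q → Ξ⊆Ψ (Θ⊆Ξ q))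

⊆⇒≼ : Θ ⊆ Ξ → B ▸ Θ ≼ B ▸ Ξ
⊆⇒≼ Θ⊆Ξ = id , Θ⊆Ξ

Monotone : Support → Set₁
Monotone K = ∀ {B Θ C Ξ} → B ▸ Θ ≼ C ▸ Ξ → K B Θ → K C Ξ

Implies : Base → FinSet Atom → Support → Support → Set₁
Implies B Θ K L = ∀ {C Ξ} → B ▸ Θ ≼ C ▸ Ξ → K C Ξ → L C Ξ

supp-At-mono : Monotone supp-At
supp-At-mono {Ξ = Ξ} (C⊇B , Θ⊆Ξ) d =
  conv (≈-refl , mk⇔ (++-lub id Θ⊆Ξ) (xs⊆xs++ys Ξ _)) (⊢-weakenʳ Ξ (⊢-base-mono C⊇B d))

supp-mono : ∀ A → Monotone K → Monotone (supp A K)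
supp-mono (atom p) m (C⊇B , Θ⊆Ξ) k = m (C⊇B , ∷⁺ʳ p Θ⊆Ξ) k
supp-mono ⊥        m e k = m e k
supp-mono (A ∧ D)  m e (a , d) = supp-mono A m e a , supp-mono D m e d
supp-mono (A ∨ D)  m e k = supp-mono A (supp-mono D m) e k
supp-mono (A ⊃ D)  m (C⊇B , Θ⊆Ξ) f E E⊇C Ψ a =
  supp-mono D m (⊆⇒≼ (++⁺ʳ Ψ Θ⊆Ξ)) (f E (λ r → E⊇C (C⊇B r)) Ψ a)

supp*-mono : ∀ Γ → Monotone (supp* Γ)
supp*-mono []      = supp-At-mono
supp*-mono (A ∷ Γ) = supp-mono A (supp*-mono Γ)

-- The implication must hold at later worlds because the recursion moves there: an atom enlarges
-- `Θ`, and `⊃` passes to an extension `C` with atoms `Ξ ++ Θ`.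
supp-map : ∀ A → Implies B Θ K L → supp A K B Θ → supp A L B Θ
supp-map (atom p) f k = f (⊆⇒≼ there) k
supp-map ⊥        f k = f ≼-refl k
supp-map (A ∧ D)  f (a , d) = supp-map A f a , supp-map D f d
supp-map (A ∨ D)  f k = supp-map A (λ e → supp-map D (λ e′ → f (≼-trans e e′))) k
supp-map (A ⊃ D)  f g C C⊇B Ξ a =
  supp-map D (λ e → f (≼-trans (C⊇B , xs⊆ys++xs _ Ξ) e)) (g C C⊇B Ξ a)

-- Weakening, exchange and contraction.

supp-weaken : ∀ A → Monotone K → K B Θ → supp A K B Θ
supp-weaken (atom p) m k = m (⊆⇒≼ there) k
supp-weaken ⊥        m k = k
supp-weaken (A ∧ D)  m k = supp-weaken A m k , supp-weaken D m k
supp-weaken (A ∨ D)  m k = supp-weaken A (supp-mono D m) (supp-weaken D m k)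
supp-weaken (A ⊃ D)  m k C C⊇B Ξ _ =
  supp-weaken D m (m (C⊇B , xs⊆ys++xs _ Ξ) k)

-- supp (A ⊃ D) K is definitionally Under A (supp D K).
Under : Formula → Support → Support
Under A K B Θ = ∀ C → C ⊇ B → ∀ Ξ → supp A supp-At C Ξ → K C (Ξ ++ Θ)

-- This lemma, `supp-×` and `supp-Under` commute `supp A` with the three operations that the clauses
-- for atoms, `∧` and `⊃` perform; they are the corresponding cases of `supp-swap`.
supp-atom : ∀ A → Monotone K →
            supp A K B (p ∷ Θ) → supp A (supp (atom p) K) B Θ
supp-atom (atom q) m k = m (⊆⇒≼ (↭⇒⊆ (↭-swap q _ ↭-refl))) k
supp-atom ⊥        m k = k
supp-atom (A ∧ D)  m (a , d) = supp-atom A m a , supp-atom D m d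
supp-atom (A ∨ D)  m k =
  supp-map A (λ _ → supp-atom D m) (supp-atom A (supp-mono D m) k)
supp-atom (A ⊃ D)  m f C C⊇B Ξ a =
  supp-atom D m (supp-mono D m (⊆⇒≼ (↭⇒⊆ (shift _ Ξ _))) (f C C⊇B Ξ a))

supp-× : ∀ A → supp A K B Θ → supp A L B Θ →
         supp A (λ C Ξ → K C Ξ × L C Ξ) B Θ
supp-× (atom p) k l = k , l
supp-× ⊥        k l = k , l
supp-× (A ∧ D)  (a , d) (a′ , d′) = supp-× A a a′ , supp-× D d d′
supp-× (A ∨ D)  k l = supp-map A (λ _ (k , l) → supp-× D k l) (supp-× A k l)
supp-× (A ⊃ D)  f g C C⊇B Ξ a = supp-× D (f C C⊇B Ξ a) (g C C⊇B Ξ a)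

supp-Under : ∀ A G → Monotone K → Under A (supp G K) B Θ → supp G (Under A K) B Θ
supp-Under A (atom p) m f C C⊇B Ξ a =
  m (⊆⇒≼ (↭⇒⊆ (↭-sym (shift p Ξ _)))) (f C C⊇B Ξ a)
supp-Under A ⊥        m f = f
supp-Under A (G ∧ H)  m f =
  supp-Under A G m (λ C C⊇B Ξ a → proj₁ (f C C⊇B Ξ a)) ,
  supp-Under A H m (λ C C⊇B Ξ a → proj₂ (f C C⊇B Ξ a))
supp-Under A (G ∨ H)  m f =
  supp-map G (λ _ → supp-Under A H m) (supp-Under A G (supp-mono H m) f)
-- Both antecedents are used at the last base `E`, to which `g` is transported; the atoms `Ξ` and
-- `Ψ` are then exchanged.
supp-Under A (G ⊃ H)  m f C C⊇B Ξ g = supp-Under A H m λ E E⊇C Ψ a →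
  supp-mono H m (⊆⇒≼ (↭⇒⊆ (shifts Ξ Ψ)))
    (f E (λ r → E⊇C (C⊇B r)) Ψ a E id Ξ (supp-mono G supp-At-mono (E⊇C , id) g))

supp-swap : ∀ A D → Monotone K → supp A (supp D K) B Θ → supp D (supp A K) B Θ
supp-swap (atom p) G m k = supp-atom G m k
supp-swap ⊥        G m k = k
supp-swap (A ∧ D)  G m (a , d) = supp-× G (supp-swap A G m a) (supp-swap D G m d)
supp-swap (A ∨ D)  G m k =
  supp-swap A G (supp-mono D m) (supp-map A (λ _ → supp-swap D G m) k)
supp-swap (A ⊃ D)  G m f =
  supp-Under A G (supp-mono D m) λ C C⊇B Ξ a → supp-swap D G m (f C C⊇B Ξ a)

supp-contract : ∀ A → Monotone K → supp A (supp A K) B Θ → supp A K B Θ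
supp-contract (atom p) m k = m (⊆⇒≼ (++-lub {xs = p ∷ []} (λ { (here refl) → here refl }) id)) k
supp-contract ⊥        m k = k
supp-contract (A ∧ D)  m (a , d) =
  supp-contract A m (supp-map A (λ _ → proj₁) a) ,
  supp-contract D m (supp-map D (λ _ → proj₂) d)
supp-contract (A ∨ D)  m k =
  -- The order A, D, A, D is first changed to A, A, D, D.
  supp-map A (λ _ → supp-contract D m)
    (supp-contract A (supp-mono D (supp-mono D m))
      (supp-map A (λ _ → supp-swap D A (supp-mono D m)) k))
supp-contract (A ⊃ D)  m f C C⊇B Ξ a =
  -- The inner implication `g` receives the same `a`; the atoms `Ξ` already belong to the current
  -- world, so their second copy is absorbed.
  supp-contract D m (supp-map D
    (λ e g → supp-mono D m (⊆⇒≼ (++-lub (λ q → atoms-⊆ e (xs⊆xs++ys Ξ _ q)) id))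
      (g _ id Ξ (supp-mono A supp-At-mono (base-⊇ e , id) a)))
    (f C C⊇B Ξ a))

supp*-weaken : ∀ Γ → supp-At B Θ → supp* Γ B Θ
supp*-weaken []      d = d
supp*-weaken (A ∷ Γ) d = supp-weaken A (supp*-mono Γ) (supp*-weaken Γ d)

supp*-absorb : A ∈ Γ → supp A (supp* Γ) B Θ → supp* Γ B Θ
supp*-absorb {Γ = A ∷ Γ}     (here refl)  k = supp-contract A (supp*-mono Γ) k
supp*-absorb {A} {Γ = D ∷ Γ} (there A∈Γ)  k =
  supp-map D (λ _ → supp*-absorb A∈Γ) (supp-swap A D (supp*-mono Γ) k)

supp*-⊆ : Γ ⊆ Δ → supp* Γ B Θ → supp* Δ B Θ
supp*-⊆ {[]}    {Δ} Γ⊆Δ k = supp*-weaken Δ k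
supp*-⊆ {A ∷ Γ} Γ⊆Δ k =
  supp*-absorb (Γ⊆Δ (here refl)) (supp-map A (λ _ → supp*-⊆ (λ D∈Γ → Γ⊆Δ (there D∈Γ))) k)

supp*-↭ : Γ ↭ Δ → supp* Γ B Θ → supp* Δ B Θ
supp*-↭ Γ↭Δ = supp*-⊆ (↭⇒⊆ Γ↭Δ)

-- Cut under side formulas `Γ`: for a singleton `Δ`, its formula is replaced by `Δ′`.
supp*-mapʳ : ∀ Γ {Δ Δ′} → Implies B Θ (supp* Δ) (supp* Δ′) →
             supp* (Γ ++ Δ) B Θ → supp* (Γ ++ Δ′) B Θ
supp*-mapʳ []      f k = f ≼-refl k
supp*-mapʳ (A ∷ Γ) f k = supp-map A (λ e → supp*-mapʳ Γ (λ e′ → f (≼-trans e e′))) k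

-- Soundness of the rules.

-- The premises of (Inf) may share one atomic context, by weakening.
AllSupp : FinSet Formula → Support
AllSupp Γ B Θ = All (λ A → supp A supp-At B Θ) Γ

AllSupp-mono : Monotone (AllSupp Γ)
AllSupp-mono e = All.map (λ {A} → supp-mono A supp-At-mono e)

-- Induction on the derivation for all worlds at once, since `L∨`, `L⊃` and `R⊃` use the hypothesis
-- at later worlds.
sound : ∀ {S} → CLp S → ∀ {B Θ} → AllSupp (ante S) B Θ → supp* (succ S) B Θ
sound (init {Γ} {Δ} {A}) γ with ++⁻ʳ Γ γ
... | a ∷ [] = supp-map A (λ _ → supp*-weaken Δ) a
sound (L⊥ {Γ} {Δ}) γ with ++⁻ʳ Γ γ
... | d ∷ [] = supp*-weaken Δ d
sound (R⊥ d) γ = sound d γ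
sound (L∧ d) ((a , b) ∷ γ) = sound d (a ∷ b ∷ γ)
sound (R∧ {Γ} {Δ} {Γ′} {Δ′} {A} {D} d d′) γ =
  supp*-↭ {A ∧ D ∷ Δ ++ Δ′}
    (↭-trans (++-comm (A ∧ D ∷ []) (Δ ++ Δ′)) (↭-reflexive (++-assoc Δ Δ′ _)))
    ( supp*-⊆ (++-lub (⊆-trans (xs⊆xs++ys Δ Δ′) there) (∷⁺ʳ A λ ())) (sound d (++⁻ˡ Γ γ))
    , supp*-⊆ (++-lub (⊆-trans (xs⊆ys++xs Δ′ Δ) there) (∷⁺ʳ D λ ())) (sound d′ (++⁻ʳ Γ γ)))
sound (L∨ {Γ} {Δ} {Γ′} {Δ′} {A} {D} d d′) (k ∷ γ) =
  -- Read from the bottom: `k` supports A, D; the second premise replaces D by `Δ′`, then the first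
  -- replaces A by `Δ`.
  supp*-↭ (++-comm Δ′ Δ) $
  supp*-mapʳ Δ′ (λ e a → sound d (a ∷ AllSupp-mono e (++⁻ˡ Γ γ))) $
  supp*-↭ (++-comm (A ∷ []) Δ′) $
  supp*-mapʳ (A ∷ []) {D ∷ []} {Δ′} (λ e b → sound d′ (b ∷ AllSupp-mono e (++⁻ʳ Γ γ))) k
sound (R∨ {Δ = Δ} d) γ = supp*-mapʳ Δ (λ _ k → k) (sound d γ)
sound (L⊃ {Γ} {Δ} {Γ′} {Δ′} {A} {D} d d′) (f ∷ γ) =
  -- At a later world supporting A, `f` yields D with atoms `Ξ ++ Θ`, which collapse to `Ξ` because
  -- `Θ` is contained in it.
  supp*-mapʳ Δ
    (λ {C} {Ξ} e a → sound d′
      ( supp-mono D supp-At-mono (⊆⇒≼ (++-lub id (atoms-⊆ e))) (f C (base-⊇ e) Ξ a)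
      ∷ AllSupp-mono e (++⁻ʳ Γ γ)))
    (sound d (++⁻ˡ Γ γ))
sound (R⊃ {Γ} {Δ} {A} {D} d) γ =
  supp*-↭ (++-comm (A ⊃ D ∷ []) Δ) λ C C⊇B Ξ a →
    supp*-↭ (++-comm Δ (D ∷ [])) (sound d
      ( supp-mono A supp-At-mono (⊆⇒≼ (xs⊆xs++ys Ξ _)) a
      ∷ AllSupp-mono (C⊇B , xs⊆ys++xs _ Ξ) γ))
sound (conv (Γ≈ , Δ≈) d) γ = supp*-⊆ (≈⇒⊆ Δ≈) (sound d (anti-mono (≈⇒⊆ Γ≈) γ))

-- With its converse, this trades the atomic contexts of (Inf), given there as formulas, for atoms
-- of the world.
supp*-atoms⁻ : ∀ Θ → supp* (map atom Θ ++ Γ) B Ξ → supp* Γ B (Θ ++ Ξ)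
supp*-atoms⁻ []      k = k
supp*-atoms⁻ {Γ = Γ} (p ∷ Θ) k =
  supp*-mono Γ (⊆⇒≼ (↭⇒⊆ (shift p Θ _))) (supp*-atoms⁻ Θ k)

supp*-atoms⁺ : ∀ Θ → supp* Γ B (Θ ++ Ξ) → supp* (map atom Θ ++ Γ) B Ξ
supp*-atoms⁺ []      k = k
supp*-atoms⁺ {Γ = Γ} (p ∷ Θ) k =
  supp*-atoms⁺ Θ (supp*-mono Γ (⊆⇒≼ (↭⇒⊆ (↭-sym (shift p Θ _)))) k)

Pointwise⇒AllSupp : ∀ {Θs} → Pointwise (λ Θ A → ⊩[ C ] (map atom Θ ++ A ∷ [])) Θs Γ →
                    AllSupp Γ C (concat Θs ++ [])
Pointwise⇒AllSupp [] = []
Pointwise⇒AllSupp {Γ = A ∷ _} {Θs = Θ ∷ Θs} (h ∷ hs) =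
  supp-mono A supp-At-mono
    (⊆⇒≼ (++-lub (⊆-trans (xs⊆xs++ys Θ _) (xs⊆xs++ys _ [])) λ ()))
    (supp*-atoms⁻ Θ h) ∷
  AllSupp-mono
    (⊆⇒≼ (⊆-trans (xs⊆ys++xs _ Θ) (↭⇒⊆ (↭-reflexive (sym (++-assoc Θ (concat Θs) []))))))
    (Pointwise⇒AllSupp hs)

theorem2 : ∀ (Γ Δ : FinSet Formula) → CLp (Γ ⇒ Δ) → Γ ⊩ Δ
theorem2 []      Δ d B _ = sound d []
theorem2 (_ ∷ _) Δ d B _ C _ Θs hs = supp*-atoms⁺ (concat Θs) (sound d (Pointwise⇒AllSupp hs))
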